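{- If the set of Wieferich primes is infinite, then the set $\mathcal{H}_\mu$ of $\mu$-hits is infinite.
   Context: A Wieferich prime is a prime $p$ such that $p^2$ divides $2^{p-1}-1$. The function $\mu:\mathbb{Z}_{\geq1}\to\mathbb{R}_{\geq 0}$ is defined by $\mu(q_1^{n_1}\cdots q_r^{n_r})=\log(q_1\cdots q_r)+\log(n_1\cdots n_r)$ for distinct primes $q_1,\ldots,q_r$ and positive integers $n_1,\ldots,n_r$ (natural logarithm; $\mu(1)=0$). $\mathcal{H}_\mu$ is the set of triples $(a,b,c)$ of positive integers with $a+b=c$, $\gcd(a,b)=1$ and $\log c>\mu(abc)$; its elements are called $\mu$-hits. -}

module Defs where

open import Data.Nat using (ℕ; zero; suc; _+_; _*_; _∸_; _^_; _<_; _/_)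
open import Data.Nat.Divisibility using (_∣_; _∣?_)
open import Data.Nat.Primality using (Prime; prime?)
open import Data.Nat.GCD using (gcd)
open import Data.List using (List; filter; map; upTo)
open import Data.Nat.ListAction using (product)
open import Data.Product using (_×_; Σ; ∃-syntax)
open import Relation.Nullary using (yes; no; ¬_; _×-dec_)
open import Relation.Binary.PropositionalEquality using (_≡_)

Wieferich : ℕ → Set
Wieferich p = Prime p × (p ^ 2 ∣ 2 ^ (p ∸ 1) ∸ 1)

-- p-adic valuation v_p(n) for p ≥ 2, n ≥ 1 (fuel n suffices since p^k ≤ n).
-- Returns 0 when p < 2 or n = 0 (never used in those cases below).
valuationFuel : ℕ → ℕ → ℕ → ℕ
valuationFuel zero p n = 0
valuationFuel (suc f) zero n = 0
valuationFuel (suc f) (suc zero) n = 0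
valuationFuel (suc f) p@(suc (suc k)) zero = 0
valuationFuel (suc f) p@(suc (suc k)) n@(suc m) with p ∣? n
... | yes _ = suc (valuationFuel f p (n / p))
... | no  _ = 0

valuation : ℕ → ℕ → ℕ
valuation p n = valuationFuel n p n

primeDivisors : ℕ → List ℕ
primeDivisors n = filter (λ p → prime? p ×-dec (p ∣? n)) (upTo (suc n))

rad : ℕ → ℕ
rad n = product (primeDivisors n)

expProd : ℕ → ℕ
expProd n = product (map (λ p → valuation p n) (primeDivisors n))

-- μ(n) = log(rad n) + log(expProd n) = log(rad n · expProd n).
-- Since log is strictly increasing, log c > μ(abc) ⟺ c > rad(abc)·expProd(abc).
IsMuHit : ℕ → ℕ → ℕ → Set
IsMuHit a b c =
  (0 < a) × (0 < b) × (a + b ≡ c) × (gcd a b ≡ 1) ×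
  (rad (a * b * c) * expProd (a * b * c) < c)

InfinitelyManyWieferich : Set
InfinitelyManyWieferich = ∀ N → ∃[ p ] (N < p × Wieferich p)

-- H_μ is infinite: for every bound N there is a μ-hit with c > N
-- (equivalent, since only finitely many triples have c ≤ N).
InfinitelyManyMuHits : Set
InfinitelyManyMuHits =
  ∀ N → ∃[ a ] ∃[ b ] ∃[ c ] (N < c × IsMuHit a b c)

{-# OPTIONS --safe #-}
module Submission where

open import Data.List using ([]; _∷_; length; map; upTo)
open import Data.List.Membership.Propositional using (_∈_)
open import Data.List.Membership.Propositional.Properties using (∈-filter⁺; ∈-filter⁻; ∈-upTo⁺)
open import Data.List.Membership.Propositional.Properties.WithK using (unique∧set⇒bag)
open import Data.List.Properties using (map-cong-local)
open import Data.List.Relation.Binary.BagAndSetEquality using (∼bag⇒↭)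
open import Data.List.Relation.Binary.Permutation.Propositional using (_↭_)
open import Data.List.Relation.Binary.Permutation.Propositional.Properties using (map⁺)
open import Data.List.Relation.Unary.All as All using (All; []; _∷_)
open import Data.List.Relation.Unary.AllPairs using ([]; _∷_)
open import Data.List.Relation.Unary.Any using (here; there)
open import Data.List.Relation.Unary.Unique.Propositional using (Unique)
open import Data.List.Relation.Unary.Unique.Propositional.Properties using (upTo⁺; filter⁺)
open import Data.Nat
open import Data.Nat.Coprimality using (Coprime; coprime-divisor)
open import Data.Nat.DivMod using (m*n/n≡m)
open import Data.Nat.Divisibility
open import Data.Nat.GCD using (gcd-zeroˡ)
open import Data.Nat.Induction using (<-rec)
open import Data.Nat.ListAction using (product)
open import Data.Nat.ListAction.Properties using (product-↭)
open import Data.Nat.Primality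
open import Data.Nat.Primality.Factorisation using (factorise)
open import Data.Nat.Properties
open import Data.Nat.Tactic.RingSolver using (solve-∀)
open import Data.Product using (_×_; _,_; proj₂; ∃-syntax)
open import Data.Sum using (inj₁; inj₂; [_,_]′)
open import Function using (mk⇔; _∘_)
open import Relation.Binary.PropositionalEquality
open import Relation.Nullary using (yes; no; contradiction; _×-dec_)
open import Relation.Nullary.Decidable using (from-yes)

open import Defs

-- For a Wieferich prime p > 1093 put n = 1092 (p − 1); then (1 , 2ⁿ − 1 , 2ⁿ) is a μ-hit. The function
-- F = exp ∘ μ is multiplicative with F(qᵏ) = q k ≤ qᵏ, and q F(qᵏ) ≤ 2 qᵏ once k ≥ 2. Since 2ⁿ − 1 is
-- divisible by the squares of p, 7, 13 and 1093, its F-value is at most 2⁴ (2ⁿ − 1) / (7 · 13 · 1093 p),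
-- and this saving outweighs the factor F(2ⁿ) = 2 n, because 2⁴ · 2 · 1092 (p − 1) < 7 · 13 · 1093 p.

-- With this function the last clause of `IsMuHit` reads `expμ (a * b * c) < c`.
expμ : ℕ → ℕ
expμ n = rad n * expProd n

-- Primes, coprimality and splitting off prime powers.

n<m^n : ∀ {m} → 1 < m → ∀ n → n < m ^ n
n<m^n 1<m zero = z<s
n<m^n {m} 1<m (suc n) = ≤-<-trans (n<m^n 1<m n) (^-monoʳ-< m 1<m (n<1+n n))

prime⇒>1 : ∀ {p} → Prime p → 1 < p
prime⇒>1 pp = nonTrivial⇒n>1 _ {{prime⇒nonTrivial pp}}

prime∣prime⇒≡ : ∀ {p q} → Prime p → Prime q → p ∣ q → p ≡ q
prime∣prime⇒≡ pp pq p∣q with prime⇒irreducible pq p∣q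
... | inj₁ refl = contradiction pp ¬prime[1]
... | inj₂ p≡q = p≡q

prime∤⇒coprime : ∀ {p n} → Prime p → p ∤ n → Coprime n p
prime∤⇒coprime pp p∤n (d∣n , d∣p) with prime⇒irreducible pp d∣p
... | inj₁ d≡1 = d≡1
... | inj₂ refl = contradiction d∣n p∤n

-- As `p` is prime and `p ∤ d`, `d` is coprime to `p`, and Gauss's lemma removes the factors `p` one
-- at a time. The divisor `d` will be a prime or the square of a prime.
∣p^k*m⇒∣m : ∀ {p d} → Prime p → p ∤ d → ∀ k {m} → d ∣ p ^ k * m → d ∣ m
∣p^k*m⇒∣m {d = d} pp p∤d zero {m} d∣ = subst (d ∣_) (*-identityˡ m) d∣
∣p^k*m⇒∣m {p} {d} pp p∤d (suc k) {m} d∣ = ∣p^k*m⇒∣m pp p∤d k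
  (coprime-divisor (prime∤⇒coprime pp p∤d) (subst (d ∣_) (*-assoc p (p ^ k) m) d∣))

∃-prime-divisor : ∀ {n} → 1 < n → ∃[ p ] Prime p × p ∣ n
∃-prime-divisor {n@(suc _)} 1<n with factorise n
... | record { factors = [] ; isFactorisation = eq } = contradiction (sym eq) (<⇒≢ 1<n)
... | record { factors = p ∷ ps ; isFactorisation = eq ; factorsPrime = pp ∷ _ } =
  p , pp , subst (p ∣_) (sym eq) (m∣m*n (product ps))

extract-power : ∀ {p} → Prime p → ∀ n → n ≢ 0 → ∃[ k ] ∃[ m ] (n ≡ p ^ k * m × p ∤ m)
extract-power {p} pp = <-rec _ step
  where
  step : ∀ n → (∀ {i} → i < n → i ≢ 0 → ∃[ k ] ∃[ m ] (i ≡ p ^ k * m × p ∤ m)) →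
         n ≢ 0 → ∃[ k ] ∃[ m ] (n ≡ p ^ k * m × p ∤ m)
  step n rec n≢0 with p ∣? n
  ... | no p∤n = 0 , n , sym (*-identityˡ n) , p∤n
  ... | yes (divides zero eq) = contradiction eq n≢0
  ... | yes (divides i@(suc _) refl) with rec (m<m*n i p (prime⇒>1 pp)) (λ ())
  ...   | k , m , i≡ , p∤m = suc k , m , trans (*-comm i p)
            (trans (cong (p *_) i≡) (sym (*-assoc p (p ^ k) m))) , p∤m

-- Valuations of `p ^ k * m`.

valuationFuel-p^k*m : ∀ {p} → Prime p → ∀ f k {m n} → p ∤ m → n ≢ 0 → n ≡ p ^ k * m → k ≤ f →
                      valuationFuel f p n ≡ k
valuationFuel-p^k*m {zero} pp = contradiction pp ¬prime[0]
valuationFuel-p^k*m {suc zero} pp = contradiction pp ¬prime[1]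
valuationFuel-p^k*m {2+ _} pp zero zero p∤m n≢0 n≡ k≤f = refl
valuationFuel-p^k*m {2+ _} pp (suc f) k {n = zero} p∤m n≢0 n≡ k≤f = contradiction refl n≢0
valuationFuel-p^k*m {p@(2+ _)} pp (suc f) k {m} {n@(suc _)} p∤m n≢0 n≡ k≤f with p ∣? n
valuationFuel-p^k*m {p@(2+ _)} pp (suc f) zero {m} p∤m n≢0 n≡ k≤f | yes p∣n =
  contradiction (subst (p ∣_) (trans n≡ (*-identityˡ m)) p∣n) p∤m
-- Dividing by `p` lowers the exponent and the fuel by one each, so the fuel stays sufficient.
valuationFuel-p^k*m {p@(2+ _)} pp (suc f) (suc k) {m} {n} p∤m n≢0 n≡ (s≤s k≤f) | yes _ =
  cong suc (valuationFuel-p^k*m pp f k p∤m n/p≢0 n/p≡ k≤f)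
  where
  n/p≡ : n / p ≡ p ^ k * m
  n/p≡ = trans (cong (_/ p) (trans n≡ (*-assoc p (p ^ k) m)))
    (trans (cong (_/ p) (*-comm p (p ^ k * m))) (m*n/n≡m (p ^ k * m) p))
  n/p≢0 : n / p ≢ 0
  n/p≢0 eq = n≢0 (trans n≡ (trans (*-assoc p (p ^ k) m)
    (trans (cong (p *_) (trans (sym n/p≡) eq)) (*-zeroʳ p))))
valuationFuel-p^k*m pp (suc f) zero p∤m n≢0 n≡ k≤f | no _ = refl
valuationFuel-p^k*m {p} pp (suc f) (suc k) {m} p∤m n≢0 n≡ k≤f | no p∤n =
  contradiction (subst (p ∣_) (sym n≡) (∣m⇒∣m*n m (m∣m*n (p ^ k)))) p∤n

p^k*m≢0 : ∀ {p} → Prime p → ∀ k {m} → p ∤ m → p ^ k * m ≢ 0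
p^k*m≢0 {p} pp k {m} p∤m eq with m*n≡0⇒m≡0∨n≡0 (p ^ k) eq
... | inj₁ p^k≡0 = contradiction (subst (0 <_) p^k≡0 (≤-<-trans z≤n (n<m^n (prime⇒>1 pp) k))) λ ()
... | inj₂ refl = p∤m (p ∣0)

valuation-p^k*m : ∀ {p} → Prime p → ∀ k {m} → p ∤ m → valuation p (p ^ k * m) ≡ k
valuation-p^k*m {p} pp k {zero} p∤m = contradiction (p ∣0) p∤m
-- The fuel is the number itself, and `k < p ^ k ≤ p ^ k * m`.
valuation-p^k*m {p} pp k {m@(suc _)} p∤m = valuationFuel-p^k*m pp _ k p∤m (p^k*m≢0 pp k p∤m) refl
  (≤-trans (<⇒≤ (n<m^n (prime⇒>1 pp) k)) (m≤m*n (p ^ k) m))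

∤p^k*m : ∀ {p r} → Prime p → Prime r → r ≢ p → ∀ k {m} → r ∤ m → r ∤ p ^ k * m
∤p^k*m pp pr r≢p k r∤m r∣ =
  r∤m (∣p^k*m⇒∣m pp (λ p∣r → r≢p (sym (prime∣prime⇒≡ pp pr p∣r))) k r∣)

-- Write `m` as `r ^ j * m′` with `r ∤ m′`. Then `r` does not divide `p ^ k * m′` either, so both
-- valuations equal `j`.
valuation-other : ∀ {p r} → Prime p → Prime r → r ≢ p → ∀ k {m} → p ∤ m →
                  valuation r (p ^ k * m) ≡ valuation r m
valuation-other {p} {r} pp pr r≢p k {m} p∤m
  with extract-power pr m (λ { refl → p∤m (p ∣0) })
... | j , m′ , refl , r∤m′ = begin
  valuation r (p ^ k * (r ^ j * m′)) ≡⟨ cong (valuation r) (swap (p ^ k) (r ^ j) m′) ⟩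
  valuation r (r ^ j * (p ^ k * m′)) ≡⟨ valuation-p^k*m pr j (∤p^k*m pp pr r≢p k r∤m′) ⟩
  j                                  ≡⟨ valuation-p^k*m pr j r∤m′ ⟨
  valuation r (r ^ j * m′)           ∎
  where
  open ≡-Reasoning
  swap : ∀ x y z → x * (y * z) ≡ y * (x * z)
  swap = solve-∀

-- Lists of prime divisors and multiplicativity of `expμ`.

∈-primeDivisors⁺ : ∀ {p n} → Prime p → p ∣ n → n ≢ 0 → p ∈ primeDivisors n
∈-primeDivisors⁺ {n = n} pp p∣n n≢0 =
  ∈-filter⁺ (λ p → prime? p ×-dec (p ∣? n)) (∈-upTo⁺ (s≤s (∣⇒≤ {{≢-nonZero n≢0}} p∣n))) (pp , p∣n)

∈-primeDivisors⁻ : ∀ {p n} → p ∈ primeDivisors n → Prime p × p ∣ n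
∈-primeDivisors⁻ {n = n} p∈ =
  proj₂ (∈-filter⁻ (λ p → prime? p ×-dec (p ∣? n)) {xs = upTo (suc n)} p∈)

primeDivisors-unique : ∀ n → Unique (primeDivisors n)
primeDivisors-unique n = filter⁺ (λ p → prime? p ×-dec (p ∣? n)) (upTo⁺ (suc n))

-- Two duplicate-free lists with the same members are permutations of each other. They need not be
-- equal: the left one is increasing, so `p` may stand anywhere in it.
primeDivisors-p^k*m : ∀ {p} → Prime p → ∀ k {m} → p ∤ m →
                      primeDivisors (p ^ suc k * m) ↭ p ∷ primeDivisors m
primeDivisors-p^k*m {p} pp k {m} p∤m = ∼bag⇒↭ (unique∧set⇒bag
  (primeDivisors-unique (p ^ suc k * m)) (All.tabulate p≢ ∷ primeDivisors-unique m) (mk⇔ to from))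
  where
  p≢ : ∀ {r} → r ∈ primeDivisors m → p ≢ r
  p≢ r∈ refl = p∤m (proj₂ (∈-primeDivisors⁻ r∈))
  to : ∀ {r} → r ∈ primeDivisors (p ^ suc k * m) → r ∈ p ∷ primeDivisors m
  to {r} r∈ with ∈-primeDivisors⁻ r∈ | r ≟ p
  ... | _ , _ | yes r≡p = here r≡p
  ... | pr , r∣ | no r≢p with r ∣? m
  ...   | yes r∣m = there (∈-primeDivisors⁺ pr r∣m (λ { refl → p∤m (p ∣0) }))
  ...   | no r∤m = contradiction r∣ (∤p^k*m pp pr r≢p (suc k) r∤m)
  from : ∀ {r} → r ∈ p ∷ primeDivisors m → r ∈ primeDivisors (p ^ suc k * m)
  from (here refl) = ∈-primeDivisors⁺ pp (∣m⇒∣m*n m (m∣m*n (p ^ k))) (p^k*m≢0 pp (suc k) p∤m)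
  from (there r∈) with ∈-primeDivisors⁻ r∈
  ... | pr , r∣m = ∈-primeDivisors⁺ pr (∣n⇒∣m*n (p ^ suc k) r∣m) (p^k*m≢0 pp (suc k) p∤m)

-- The new prime contributes `p` to `rad` and its valuation `k` to `expProd`, while the primes of
-- `m` keep their valuations. At `k = 0` the right side would vanish.
expμ-p^k*m : ∀ {p} → Prime p → ∀ k .{{_ : NonZero k}} {m} → p ∤ m →
             expμ (p ^ k * m) ≡ p * k * expμ m
expμ-p^k*m {p} pp k@(suc k′) {m} p∤m = begin
  expμ n                                     ≡⟨ cong₂ _*_ rad≡ expProd≡ ⟩
  p * rad m * (k * expProd m)                ≡⟨ regroup p (rad m) k (expProd m) ⟩
  p * k * expμ m                             ∎
  where
  open ≡-Reasoning
  n = p ^ k * m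
  regroup : ∀ a b c d → a * b * (c * d) ≡ a * c * (b * d)
  regroup = solve-∀
  perm : primeDivisors n ↭ p ∷ primeDivisors m
  perm = primeDivisors-p^k*m pp k′ p∤m
  rad≡ : rad n ≡ p * rad m
  rad≡ = product-↭ perm
  others : ∀ {r} → r ∈ primeDivisors m → valuation r n ≡ valuation r m
  others r∈ with ∈-primeDivisors⁻ r∈
  ... | pr , r∣m = valuation-other pp pr (λ { refl → p∤m r∣m }) k p∤m
  expProd≡ : expProd n ≡ k * expProd m
  expProd≡ = begin
    expProd n
      ≡⟨ product-↭ (map⁺ (λ r → valuation r n) perm) ⟩
    valuation p n * product (map (λ r → valuation r n) (primeDivisors m))
      ≡⟨ cong₂ _*_ (valuation-p^k*m pp k p∤m) (cong product (map-cong-local (All.tabulate others))) ⟩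
    k * expProd m ∎

-- Upper bounds for `expμ`.

expμ-≤ : ∀ n → n ≢ 0 → expμ n ≤ n
expμ-≤ = <-rec _ step
  where
  step : ∀ n → (∀ {i} → i < n → i ≢ 0 → expμ i ≤ i) → n ≢ 0 → expμ n ≤ n
  step zero rec n≢0 = contradiction refl n≢0
  step (suc zero) rec n≢0 = ≤-refl
  step n@(2+ _) rec n≢0 with ∃-prime-divisor {n} (s<s z<s)
  ... | p , pp , p∣n with extract-power pp n n≢0
  ...   | zero , m , n≡ , p∤m = contradiction (subst (p ∣_) (trans n≡ (*-identityˡ m)) p∣n) p∤m
  ...   | suc k , zero , n≡ , p∤m = contradiction (p ∣0) p∤m
  ...   | suc k , m@(suc _) , n≡ , p∤m = begin
    expμ n                   ≡⟨ cong expμ n≡ ⟩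
    expμ (p ^ suc k * m)     ≡⟨ expμ-p^k*m pp (suc k) p∤m ⟩
    -- The bound `k < p ^ k` is `suc k ≤ p ^ k`, which gives `p * suc k ≤ p ^ suc k`.
    p * suc k * expμ m       ≤⟨ *-mono-≤ (*-monoʳ-≤ p (n<m^n (prime⇒>1 pp) k)) (rec m<n λ ()) ⟩
    p ^ suc k * m            ≡⟨ n≡ ⟨
    n                        ∎
    where
    open ≤-Reasoning
    m<n : m < n
    m<n = subst (m <_) (sym n≡) (subst (m <_) (*-comm m (p ^ suc k))
      (m<m*n m (p ^ suc k) (≤-<-trans (s≤s z≤n) (n<m^n (prime⇒>1 pp) (suc k)))))

-- With `k = 2 + j`, cancelling the square of `p` leaves `2 + j ≤ 2 * p ^ j`. Equality at `j = 0`
-- shows that the constant 2 is best possible.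
p*[p*k]≤2*p^k : ∀ {p} → 1 < p → ∀ {k} → 2 ≤ k → p * (p * k) ≤ 2 * p ^ k
p*[p*k]≤2*p^k 1<p {suc zero} (s≤s ())
p*[p*k]≤2*p^k {p} 1<p {2+ j} _ = begin
  p * (p * (2 + j))       ≤⟨ *-monoʳ-≤ p (*-monoʳ-≤ p 2+j≤) ⟩
  p * (p * (2 * p ^ j))   ≡⟨ regroup p (p ^ j) ⟩
  2 * p ^ (2 + j)         ∎
  where
  open ≤-Reasoning
  regroup : ∀ x y → x * (x * (2 * y)) ≡ 2 * (x * (x * y))
  regroup = solve-∀
  2+j≤ : 2 + j ≤ 2 * p ^ j
  2+j≤ = begin
    2 + j             ≤⟨ m≤m+n (2 + j) j ⟩
    2 + j + j         ≡⟨ double j ⟩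
    2 * suc j         ≤⟨ *-monoʳ-≤ 2 (n<m^n 1<p j) ⟩
    2 * p ^ j         ∎
    where
    double : ∀ x → 2 + x + x ≡ 2 * (1 + x)
    double = solve-∀

p²∣p^k*m⇒2≤k : ∀ {p} → Prime p → ∀ k {m} → p ∤ m → p ^ 2 ∣ p ^ k * m → 2 ≤ k
p²∣p^k*m⇒2≤k {p} pp zero {m} p∤m p²∣ =
  contradiction (∣-trans (m∣m*n (p ^ 1)) (subst (p ^ 2 ∣_) (*-identityˡ m) p²∣)) p∤m
p²∣p^k*m⇒2≤k {p} pp (suc zero) {m} p∤m p²∣ = contradiction
  (*-cancelˡ-∣ p {{prime⇒nonZero pp}}
    (subst₂ _∣_ (cong (p *_) (*-identityʳ p)) (cong (_* m) (*-identityʳ p)) p²∣)) p∤m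
p²∣p^k*m⇒2≤k pp (2+ k) p∤m p²∣ = s≤s (s≤s z≤n)

-- Each prime `q` whose square divides `n` saves a factor `q / 2` over `expμ-≤`. The induction
-- removes the full power of the first prime from `n` and continues with the cofactor.
expμ-squares : ∀ {qs n} → Unique qs → All Prime qs → All (λ q → q ^ 2 ∣ n) qs → n ≢ 0 →
               product qs * expμ n ≤ 2 ^ length qs * n
expμ-squares {n = n} [] [] [] n≢0 = *-monoʳ-≤ 1 (expμ-≤ n n≢0)
expμ-squares {q ∷ qs} {n} (q≢ ∷ uniq) (pq ∷ pqs) (q²∣n ∷ qs²∣n) n≢0
  with extract-power pq n n≢0
... | k , m , refl , q∤m = begin
  q * product qs * expμ (q ^ k * m)         ≡⟨ cong (q * product qs *_) (expμ-p^k*m pq k {{k≢0}} q∤m) ⟩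
  q * product qs * (q * k * expμ m)         ≡⟨ regroup q (product qs) k (expμ m) ⟩
  q * (q * k) * (product qs * expμ m)       ≤⟨ *-mono-≤ (p*[p*k]≤2*p^k (prime⇒>1 pq) 2≤k) rest ⟩
  2 * q ^ k * (2 ^ length qs * m)           ≡⟨ regroup′ (q ^ k) (2 ^ length qs) m ⟩
  2 * 2 ^ length qs * (q ^ k * m)           ∎
  where
  open ≤-Reasoning
  regroup : ∀ a b c d → a * b * (a * c * d) ≡ a * (a * c) * (b * d)
  regroup = solve-∀
  regroup′ : ∀ a b c → 2 * a * (b * c) ≡ 2 * b * (a * c)
  regroup′ = solve-∀
  2≤k : 2 ≤ k
  2≤k = p²∣p^k*m⇒2≤k pq k q∤m q²∣n
  k≢0 : NonZero k
  k≢0 = >-nonZero (≤-trans (s≤s z≤n) 2≤k)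
  -- The remaining squares survive the removal of `q ^ k`, being coprime to `q`.
  square∣m : ∀ {r} → Prime r × q ≢ r × r ^ 2 ∣ q ^ k * m → r ^ 2 ∣ m
  square∣m {r} (pr , q≢r , r²∣) = ∣p^k*m⇒∣m pq q∤r² k r²∣
    where
    q∤r : q ∤ r
    q∤r q∣r = q≢r (prime∣prime⇒≡ pq pr q∣r)
    q∤r² : q ∤ r ^ 2
    q∤r² q∣r² = [ q∤r , q∤r ∘ subst (q ∣_) (*-identityʳ r) ]′ (euclidsLemma r (r ^ 1) pq q∣r²)
  rest : product qs * expμ m ≤ 2 ^ length qs * m
  rest = expμ-squares uniq pqs (All.map square∣m (All.zip (pqs , All.zip (q≢ , qs²∣n))))
    (λ { refl → q∤m (q ∣0) })

-- Divisors of `2 ^ n ∸ 1`.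

n∣[1+n]^k∸1 : ∀ n k → n ∣ suc n ^ k ∸ 1
n∣[1+n]^k∸1 n zero = n ∣0
-- The next power is `suc n ^ k + n * suc n ^ k`; as `suc n ^ k` is positive, the 1 can be
-- subtracted from the first summand.
n∣[1+n]^k∸1 n (suc k) = subst (n ∣_) (sym (+-∸-comm (n * suc n ^ k) (m^n>0 (suc n) k)))
  (∣m∣n⇒∣m+n (n∣[1+n]^k∸1 n k) (m∣m*n (suc n ^ k)))

2^a∸1∣2^[a*b]∸1 : ∀ a b → 2 ^ a ∸ 1 ∣ 2 ^ (a * b) ∸ 1
2^a∸1∣2^[a*b]∸1 a b = subst (λ x → 2 ^ a ∸ 1 ∣ x ∸ 1)
  (trans (cong (_^ b) (m+[n∸m]≡n (m^n>0 2 a))) (^-*-assoc 2 a b))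
  (n∣[1+n]^k∸1 (2 ^ a ∸ 1) b)

2∤2^n∸1 : ∀ n .{{_ : NonZero n}} → 2 ∤ 2 ^ n ∸ 1
2∤2^n∸1 n@(suc n′) 2∣ = contradiction (∣1⇒≡1 (∣m+n∣m⇒∣n
  (subst (2 ∣_) (sym (m∸n+n≡m (m^n>0 2 n))) (m∣m*n (2 ^ n′))) 2∣)) λ ()

-- Construction of the hits.

expμ[1*m*2^n] : ∀ n .{{_ : NonZero n}} {m} → 2 ∤ m → expμ (1 * m * 2 ^ n) ≡ 2 * n * expμ m
expμ[1*m*2^n] n {m} 2∤m = trans
  (cong expμ (trans (cong (_* 2 ^ n) (*-identityˡ m)) (*-comm m (2 ^ n))))
  (expμ-p^k*m prime[2] n 2∤m)

-- By `expμ-squares` the primes in `qs` save a factor `product qs / 2 ^ length qs`, and the last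
-- hypothesis says that this covers the factor `2 * n` coming from `2 ^ n`.
muHit : ∀ n .{{_ : NonZero n}} qs → Unique qs → All Prime qs → All (λ q → q ^ 2 ∣ 2 ^ n ∸ 1) qs →
        2 ^ length qs * (2 * n) ≤ product qs → IsMuHit 1 (2 ^ n ∸ 1) (2 ^ n)
muHit n qs uniq primes squares large =
  z<s , n≢0⇒n>0 M≢0 , m+[n∸m]≡n (m^n>0 2 n) , gcd-zeroˡ M , small
  where
  M = 2 ^ n ∸ 1
  D = product qs
  M≢0 : M ≢ 0
  M≢0 M≡0 = 2∤2^n∸1 n (subst (2 ∣_) (sym M≡0) (2 ∣0))
  regroup : ∀ a b c → a * (b * c) ≡ b * (a * c)
  regroup = solve-∀
  regroup′ : ∀ a b c → a * (b * c) ≡ b * a * c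
  regroup′ = solve-∀
  -- The comparison is multiplied through by `D` to avoid division; `D` is cancelled in `small`.
  scaled : D * (2 * n * expμ M) ≤ D * M
  scaled = begin
    D * (2 * n * expμ M)          ≡⟨ regroup D (2 * n) (expμ M) ⟩
    2 * n * (D * expμ M)          ≤⟨ *-monoʳ-≤ (2 * n) (expμ-squares uniq primes squares M≢0) ⟩
    2 * n * (2 ^ length qs * M)   ≡⟨ regroup′ (2 * n) (2 ^ length qs) M ⟩
    2 ^ length qs * (2 * n) * M   ≤⟨ *-monoˡ-≤ M large ⟩
    D * M                         ∎
    where open ≤-Reasoning
  small : expμ (1 * M * 2 ^ n) < 2 ^ n
  small = begin-strict
    expμ (1 * M * 2 ^ n)   ≡⟨ expμ[1*m*2^n] n (2∤2^n∸1 n) ⟩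
    2 * n * expμ M         ≤⟨ *-cancelˡ-≤ D {{productOfPrimes≢0 primes}} scaled ⟩
    M                      <⟨ ≤-reflexive (m+[n∸m]≡n (m^n>0 2 n)) ⟩
    2 ^ n                  ∎
    where open ≤-Reasoning

-- 1093 is itself a Wieferich prime; for q = 7 and q = 13 use Euler's theorem, as φ(q²) = q (q − 1) divides 1092.
square-divisors : All (λ q → q ^ 2 ∣ 2 ^ 1092 ∸ 1) (7 ∷ 13 ∷ 1093 ∷ [])
square-divisors = from-yes (All.all? (λ q → q ^ 2 ∣? 2 ^ 1092 ∸ 1) (7 ∷ 13 ∷ 1093 ∷ []))

auxiliary-primes : All Prime (7 ∷ 13 ∷ 1093 ∷ [])
auxiliary-primes = from-yes (All.all? prime? (7 ∷ 13 ∷ 1093 ∷ []))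

theorem3 : InfinitelyManyWieferich → InfinitelyManyMuHits
-- The bound serves twice: `p > N` makes `2 ^ n` exceed `N`, and `p > 1093` keeps `p` distinct from
-- 7, 13 and 1093.
theorem3 infinite N with infinite (N + 1093)
... | suc r , N+1093<p , pp , p²∣ =
  1 , 2 ^ n ∸ 1 , 2 ^ n , N<2^n , muHit n qs uniq (pp ∷ auxiliary-primes) squares large
  where
  open ≤-Reasoning
  p = suc r
  -- A common multiple of `p ∸ 1` and 1092, so `2 ^ n ∸ 1` inherits the square divisors belonging to
  -- both exponents.
  n = 1092 * r
  qs = p ∷ 7 ∷ 13 ∷ 1093 ∷ []
  instance
    r≢0 : NonZero r
    r≢0 = ≢-nonZero λ { refl → ¬prime[1] pp }
    n≢0 : NonZero n
    n≢0 = m*n≢0 1092 r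
  1093<p : 1093 < p
  1093<p = ≤-<-trans (m≤n+m 1093 N) N+1093<p
  N<2^n : N < 2 ^ n
  N<2^n = begin-strict
    N          ≤⟨ m≤m+n N 1093 ⟩
    N + 1093   ≤⟨ s≤s⁻¹ N+1093<p ⟩
    r          ≤⟨ m≤n*m r 1092 ⟩
    n          <⟨ n<m^n (s<s z<s) n ⟩
    2 ^ n      ∎
  uniq : Unique qs
  uniq = (p≢ 7 (from-yes (7 ≤? 1093)) ∷ p≢ 13 (from-yes (13 ≤? 1093)) ∷ p≢ 1093 ≤-refl ∷ [])
    ∷ ((λ ()) ∷ (λ ()) ∷ []) ∷ ((λ ()) ∷ []) ∷ [] ∷ []
    where
    p≢ : ∀ q → q ≤ 1093 → p ≢ q
    p≢ q q≤ = >⇒≢ (≤-<-trans q≤ 1093<p)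
  squares : All (λ q → q ^ 2 ∣ 2 ^ n ∸ 1) qs
  squares =
    subst (λ e → p ^ 2 ∣ 2 ^ e ∸ 1) (*-comm r 1092) (∣-trans p²∣ (2^a∸1∣2^[a*b]∸1 r 1092)) ∷
    All.map (λ q²∣ → ∣-trans q²∣ (2^a∸1∣2^[a*b]∸1 1092 r)) square-divisors
  large : 2 ^ 4 * (2 * n) ≤ product qs
  large = begin
    16 * (2 * (1092 * r))       ≡⟨ *-assoc 16 2 (1092 * r) ⟨
    32 * (1092 * r)             ≡⟨ *-assoc 32 1092 r ⟨
    -- Here 99463 is `7 * 13 * 1093`. Both 7 and 13 matter: without 7 the coefficients would be
    -- 17472 and 14209, and without 13 they would be 17472 and 7651.
    34944 * r                   ≤⟨ *-mono-≤ (from-yes (34944 ≤? 99463)) (n≤1+n r) ⟩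
    99463 * p                   ≡⟨ *-comm 99463 p ⟩
    p * 99463                   ∎
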